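{- Let $(C,e,\lambda,\oplus)$ be a Catalan structure and let $h\colon C\to C$ be the map defined in the context. Then $h$ is an involution, i.e. $h(h(t))=t$ for all $t\in C$.
   Context: A Catalan structure is a quadruple $(C,e,\lambda,\oplus)$ where $C=\bigsqcup_{n\ge 0}C_n$ with $C_0=\{e\}$ ($|t|=n$ for $t\in C_n$), $\lambda\colon C_n\to C_{n+1}$, $\oplus\colon C_m\times C_n\to C_{m+n}$, $\oplus$ is associative with two-sided identity $e$, and every $t\in C$ can be written uniquely in exactly one of three forms: $t=e$; $t=\lambda(s)$ with $s\in C$ (indecomposable); $t=u\oplus v$ with $u$ indecomposable and $v\in C\setminus C_0$ (decomposable). Hence every nonempty $t$ is uniquely $\lambda(u)\oplus v$ ($v=e$ allowed). Put $\gamma(t)=t\oplus\lambda(e)$ and define $\ominus$ by $e\ominus v=v$, $\lambda(u)\ominus v=\lambda(u\ominus v)$, $(t\oplus u)\ominus v=t\oplus(u\ominus v)$ for $t,u\ne e$ (well defined; one may take $t$ indecomposable). The map $h$ is defined by $h(e)=e$, $h(\lambda(t))=\gamma(h(t))$, $h(u\oplus v)=h(v)\ominus h(u)$; equivalently $h(e)=e$ and $h(\lambda(u)\oplus v)=h(v)\ominus\gamma(h(u))$. -}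

module Defs where

open import Algebra.Structures using (IsMonoid)
open import Data.Empty using (⊥-elim)
open import Data.Nat using (ℕ; suc; _+_; _<_)
open import Data.Nat.Induction using (<-wellFounded)
open import Data.Nat.Properties using (m+n≡0⇒n≡0; ≤-reflexive; m<m+n; m<n+m; n≢0⇒n>0)
open import Data.Product using (∃; ∃₂; _×_; _,_)
open import Data.Sum using (_⊎_; inj₁; inj₂)
open import Induction.WellFounded using (Acc; acc)
open import Level using (Level) renaming (suc to lsuc)
open import Relation.Binary.PropositionalEquality
open import Relation.Nullary using (¬_)

-- The grading C = ⨆ₙ Cₙ is given by the size function: Cₙ is the fibre of
-- ∣_∣ over n.
record CatalanStructure (ℓ : Level) : Set (lsuc ℓ) where
  infixr 6 _⊕_
  field
    C    : Set ℓ
    ∣_∣  : C → ℕ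
    e    : C
    ƛ    : C → C
    _⊕_  : C → C → C

    ∣e∣≡0   : ∣ e ∣ ≡ 0
    ∣t∣≡0⇒e : ∀ t → ∣ t ∣ ≡ 0 → t ≡ e
    ∣ƛ∣     : ∀ t → ∣ ƛ t ∣ ≡ suc ∣ t ∣
    ∣⊕∣     : ∀ t u → ∣ t ⊕ u ∣ ≡ ∣ t ∣ + ∣ u ∣

    ⊕-isMonoid : IsMonoid _≡_ _⊕_ e

  Indecomposable : C → Set ℓ
  Indecomposable t = ∃ λ s → t ≡ ƛ s

  Decomposable : C → Set ℓ
  Decomposable t = ∃₂ λ u v → Indecomposable u × v ≢ e × t ≡ u ⊕ v

  field
    form         : ∀ t → t ≡ e ⊎ Indecomposable t ⊎ Decomposable t
    e-¬indec     : ¬ Indecomposable e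
    e-¬dec       : ¬ Decomposable e
    indec-¬dec   : ∀ t → Indecomposable t → ¬ Decomposable t
    ƛ-injective  : ∀ {s s′} → ƛ s ≡ ƛ s′ → s ≡ s′
    ⊕-injective  : ∀ {u u′ v v′} → Indecomposable u → Indecomposable u′ →
                   v ≢ e → v′ ≢ e → u ⊕ v ≡ u′ ⊕ v′ → u ≡ u′ × v ≡ v′

module Catalan {ℓ : Level} (S : CatalanStructure ℓ) where
  open CatalanStructure S public
  open IsMonoid ⊕-isMonoid using (assoc)

  -- Iterated decomposition of an element; ⊖ and h are defined by structural
  -- recursion on it.  The result does not depend on the choice of decomposition
  -- (⊖-view-unique, h-view-unique), so that both operations satisfy their
  -- defining equations (⊖-e, ⊖-ƛ, ⊖-⊕, h-e, h-ƛ, h-⊕).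
  data View : C → Set ℓ where
    empty : View e
    indec : ∀ {s} → View s → View (ƛ s)
    dec   : ∀ {u v} → Indecomposable u → v ≢ e → View u → View v → View (u ⊕ v)

  ≢e⇒0< : ∀ {t} → t ≢ e → 0 < ∣ t ∣
  ≢e⇒0< t≢e = n≢0⇒n>0 λ p → t≢e (∣t∣≡0⇒e _ p)

  indec⇒≢e : ∀ {t} → Indecomposable t → t ≢ e
  indec⇒≢e i refl = e-¬indec i

  view : ∀ t → View t
  view t = go t (<-wellFounded ∣ t ∣)
    where
    go : ∀ t → Acc _<_ ∣ t ∣ → View t
    go t (acc rs) with form t
    ... | inj₁ refl = empty
    ... | inj₂ (inj₁ (s , refl)) = indec (go s (rs (≤-reflexive (sym (∣ƛ∣ s)))))
    ... | inj₂ (inj₂ (u , v , i , v≢e , refl)) =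
      dec i v≢e
        (go u (rs (subst (∣ u ∣ <_) (sym (∣⊕∣ u v)) (m<m+n ∣ u ∣ (≢e⇒0< v≢e)))))
        (go v (rs (subst (∣ v ∣ <_) (sym (∣⊕∣ u v)) (m<n+m ∣ v ∣ (≢e⇒0< (indec⇒≢e i))))))

  γ : C → C
  γ t = t ⊕ ƛ e

  ⊖-view : ∀ {t} → View t → C → C
  ⊖-view empty                 w = w
  ⊖-view (indec s)             w = ƛ (⊖-view s w)
  ⊖-view (dec {u = u} _ _ _ v) w = u ⊕ ⊖-view v w

  infixr 6 _⊖_
  _⊖_ : C → C → C
  t ⊖ w = ⊖-view (view t) w

  h-view : ∀ {t} → View t → C
  h-view empty         = e
  h-view (indec s)     = γ (h-view s)
  h-view (dec _ _ u v) = h-view v ⊖ h-view u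

  h : C → C
  h t = h-view (view t)

  ⊖-view-unique : ∀ {t t′} (p : View t) (q : View t′) → t ≡ t′ →
                  ∀ w → ⊖-view p w ≡ ⊖-view q w
  ⊖-view-unique empty empty eq w = refl
  ⊖-view-unique empty (indec q) eq w = ⊥-elim (e-¬indec (_ , eq))
  ⊖-view-unique empty (dec i n _ _) eq w = ⊥-elim (e-¬dec (_ , _ , i , n , eq))
  ⊖-view-unique (indec p) empty eq w = ⊥-elim (e-¬indec (_ , sym eq))
  ⊖-view-unique (indec p) (indec q) eq w =
    cong ƛ (⊖-view-unique p q (ƛ-injective eq) w)
  ⊖-view-unique (indec p) (dec i n _ _) eq w =
    ⊥-elim (indec-¬dec _ (_ , refl) (_ , _ , i , n , eq))
  ⊖-view-unique (dec i n _ _) empty eq w = ⊥-elim (e-¬dec (_ , _ , i , n , sym eq))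
  ⊖-view-unique (dec i n _ _) (indec q) eq w =
    ⊥-elim (indec-¬dec _ (_ , refl) (_ , _ , i , n , sym eq))
  ⊖-view-unique (dec i n _ p) (dec i′ n′ _ q) eq w with ⊕-injective i i′ n n′ eq
  ... | u≡u′ , v≡v′ = cong₂ _⊕_ u≡u′ (⊖-view-unique p q v≡v′ w)

  h-view-unique : ∀ {t t′} (p : View t) (q : View t′) → t ≡ t′ → h-view p ≡ h-view q
  h-view-unique empty empty eq = refl
  h-view-unique empty (indec q) eq = ⊥-elim (e-¬indec (_ , eq))
  h-view-unique empty (dec i n _ _) eq = ⊥-elim (e-¬dec (_ , _ , i , n , eq))
  h-view-unique (indec p) empty eq = ⊥-elim (e-¬indec (_ , sym eq))
  h-view-unique (indec p) (indec q) eq = cong γ (h-view-unique p q (ƛ-injective eq))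
  h-view-unique (indec p) (dec i n _ _) eq =
    ⊥-elim (indec-¬dec _ (_ , refl) (_ , _ , i , n , eq))
  h-view-unique (dec i n _ _) empty eq = ⊥-elim (e-¬dec (_ , _ , i , n , sym eq))
  h-view-unique (dec i n _ _) (indec q) eq =
    ⊥-elim (indec-¬dec _ (_ , refl) (_ , _ , i , n , sym eq))
  h-view-unique (dec i n pu pv) (dec i′ n′ qu qv) eq with ⊕-injective i i′ n n′ eq
  ... | u≡u′ , v≡v′ = cong₂ _⊖_ (h-view-unique pv qv v≡v′) (h-view-unique pu qu u≡u′)

  ⊖-e : ∀ w → e ⊖ w ≡ w
  ⊖-e = ⊖-view-unique (view e) empty refl

  ⊖-ƛ : ∀ u w → ƛ u ⊖ w ≡ ƛ (u ⊖ w)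
  ⊖-ƛ u = ⊖-view-unique (view (ƛ u)) (indec (view u)) refl

  ⊖-⊕ : ∀ t u w → t ≢ e → u ≢ e → (t ⊕ u) ⊖ w ≡ t ⊕ (u ⊖ w)
  ⊖-⊕ t u w t≢e u≢e = go (view t) t≢e
    where
    ⊕≢e : ∀ v → v ⊕ u ≢ e
    ⊕≢e v eq = u≢e (∣t∣≡0⇒e u (m+n≡0⇒n≡0 ∣ v ∣
      (trans (sym (∣⊕∣ v u)) (trans (cong ∣_∣ eq) ∣e∣≡0))))

    base : ∀ {t v} → Indecomposable t → v ≢ e → (t ⊕ v) ⊖ w ≡ t ⊕ (v ⊖ w)
    base {t} {v} i v≢e =
      ⊖-view-unique (view (t ⊕ v)) (dec i v≢e (view t) (view v)) refl w

    go : ∀ {t} → View t → t ≢ e → (t ⊕ u) ⊖ w ≡ t ⊕ (u ⊖ w)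
    go empty t≢e = ⊥-elim (t≢e refl)
    go (indec _) _ = base (_ , refl) u≢e
    go (dec {t₁} {t₂} i t₂≢e _ q) _ = begin
      ((t₁ ⊕ t₂) ⊕ u) ⊖ w  ≡⟨ cong (_⊖ w) (assoc t₁ t₂ u) ⟩
      (t₁ ⊕ (t₂ ⊕ u)) ⊖ w  ≡⟨ base i (⊕≢e t₂) ⟩
      t₁ ⊕ ((t₂ ⊕ u) ⊖ w)  ≡⟨ cong (t₁ ⊕_) (go q t₂≢e) ⟩
      t₁ ⊕ (t₂ ⊕ (u ⊖ w))  ≡⟨ assoc t₁ t₂ (u ⊖ w) ⟨
      (t₁ ⊕ t₂) ⊕ (u ⊖ w)  ∎
      where open ≡-Reasoning

  h-e : h e ≡ e
  h-e = h-view-unique (view e) empty refl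

  h-ƛ : ∀ t → h (ƛ t) ≡ γ (h t)
  h-ƛ t = h-view-unique (view (ƛ t)) (indec (view t)) refl

  h-⊕ : ∀ u v → Indecomposable u → v ≢ e → h (u ⊕ v) ≡ h v ⊖ h u
  h-⊕ u v i v≢e =
    h-view-unique (view (u ⊕ v)) (dec i v≢e (view u) (view v)) refl

{-# OPTIONS --safe #-}
module Submission where

-- The triple (γ, ⊖, e) mirrors (ƛ, ⊕, e), and h is the anti-homomorphism that
-- sends ƛ to γ and ⊕ to ⊖ with reversed arguments.  It also translates back:
-- h (γ t) = ƛ (h t) and h (t ⊖ w) = h w ⊕ h t.  Hence h ∘ h commutes with ƛ and
-- ⊕ and fixes e, so it is the identity.

open import Defs
open import Algebra.Structures using (IsMonoid)
open import Data.Empty using (⊥-elim)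
open import Data.Nat.Properties using (m+n≡0⇒m≡0; m+n≡0⇒n≡0)
open import Data.Product using (_,_)
open import Level using (Level)
open import Relation.Binary.PropositionalEquality
  using (_≡_; _≢_; refl; sym; trans; cong; cong₂; module ≡-Reasoning)

module _ {ℓ : Level} (S : CatalanStructure ℓ) where
  open Catalan S
  open IsMonoid ⊕-isMonoid using (assoc; identityˡ; identityʳ)
  open ≡-Reasoning

  ƛ≢e : ∀ {t} → ƛ t ≢ e
  ƛ≢e = indec⇒≢e (_ , refl)

  ⊕-≢eˡ : ∀ {t} u → t ≢ e → t ⊕ u ≢ e
  ⊕-≢eˡ {t} u t≢e eq = t≢e (∣t∣≡0⇒e t (m+n≡0⇒m≡0 ∣ t ∣
    (trans (sym (∣⊕∣ t u)) (trans (cong ∣_∣ eq) ∣e∣≡0))))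

  ⊕-≢eʳ : ∀ t {u} → u ≢ e → t ⊕ u ≢ e
  ⊕-≢eʳ t {u} u≢e eq = u≢e (∣t∣≡0⇒e u (m+n≡0⇒n≡0 ∣ t ∣
    (trans (sym (∣⊕∣ t u)) (trans (cong ∣_∣ eq) ∣e∣≡0))))

  -- The outer `ƛ` or the first factor of `t` survives at the head of the result.
  ⊖-≢eˡ : ∀ {t} w → t ≢ e → t ⊖ w ≢ e
  ⊖-≢eˡ {t} w = go (view t)
    where
    go : ∀ {t} (p : View t) → t ≢ e → ⊖-view p w ≢ e
    go empty         t≢e = ⊥-elim (t≢e refl)
    go (indec _)     _   = ƛ≢e
    go (dec i _ _ _) _   = ⊕-≢eˡ _ (indec⇒≢e i)

  h-≢e : ∀ {t} → t ≢ e → h t ≢ e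
  h-≢e {t} = go (view t)
    where
    go : ∀ {t} (p : View t) → t ≢ e → h-view p ≢ e
    go empty           t≢e = ⊥-elim (t≢e refl)
    go (indec _)       _   = ⊕-≢eʳ _ ƛ≢e
    go (dec _ v≢e _ q) _   = ⊖-≢eˡ _ (go q v≢e)

  -- Extends `⊖-⊕` to an empty left factor. With `u` empty the law breaks: `ƛ e ⊖ w` is `ƛ w`, not
  -- `ƛ e ⊕ w`.
  ⊕-⊖-assoc : ∀ t {u} w → u ≢ e → (t ⊕ u) ⊖ w ≡ t ⊕ (u ⊖ w)
  ⊕-⊖-assoc t {u} w u≢e with view t
  ... | empty         = trans (cong (_⊖ w) (identityˡ u)) (sym (identityˡ (u ⊖ w)))
  ... | indec _       = ⊖-⊕ _ u w ƛ≢e u≢e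
  ... | dec i _ _ _   = ⊖-⊕ _ u w (⊕-≢eˡ _ (indec⇒≢e i)) u≢e

  h-ƛe : h (ƛ e) ≡ ƛ e
  h-ƛe = begin
    h (ƛ e)    ≡⟨ h-ƛ e ⟩
    h e ⊕ ƛ e  ≡⟨ cong γ h-e ⟩
    e ⊕ ƛ e    ≡⟨ identityˡ (ƛ e) ⟩
    ƛ e        ∎

  -- The mirror image of the definition of `γ`: `ƛ` arises from `⊖` and `ƛ e` as `γ` does from `⊕`
  -- and `ƛ e`, on the other side.
  ƛe-⊖ : ∀ w → ƛ e ⊖ w ≡ ƛ w
  ƛe-⊖ w = trans (⊖-ƛ e w) (cong ƛ (⊖-e w))

  -- `γ` appends a last factor `ƛ e`; the reversal in `h` brings it to the front, where `⊖` turns it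
  -- into an outer `ƛ`.
  h-γ : ∀ t → h (γ t) ≡ ƛ (h t)
  h-γ t = go (view t)
    where
    go : ∀ {t} → View t → h (γ t) ≡ ƛ (h t)
    go empty = begin
      h (e ⊕ ƛ e)  ≡⟨ cong h (identityˡ (ƛ e)) ⟩
      h (ƛ e)      ≡⟨ h-ƛe ⟩
      ƛ e          ≡⟨ cong ƛ h-e ⟨
      ƛ (h e)      ∎
    go (indec {s} _) = begin
      h (ƛ s ⊕ ƛ e)      ≡⟨ h-⊕ (ƛ s) (ƛ e) (s , refl) ƛ≢e ⟩
      h (ƛ e) ⊖ h (ƛ s)  ≡⟨ cong (_⊖ h (ƛ s)) h-ƛe ⟩
      ƛ e ⊖ h (ƛ s)      ≡⟨ ƛe-⊖ (h (ƛ s)) ⟩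
      ƛ (h (ƛ s))        ∎
    go (dec {u} {v} i v≢e _ q) = begin
      -- Reassociating restores an indecomposable first factor and moves `γ` onto `v`, where the
      -- induction hypothesis applies.
      h ((u ⊕ v) ⊕ ƛ e)  ≡⟨ cong h (assoc u v (ƛ e)) ⟩
      h (u ⊕ γ v)        ≡⟨ h-⊕ u (γ v) i (⊕-≢eʳ v ƛ≢e) ⟩
      h (γ v) ⊖ h u      ≡⟨ cong (_⊖ h u) (go q) ⟩
      ƛ (h v) ⊖ h u      ≡⟨ ⊖-ƛ (h v) (h u) ⟩
      ƛ (h v ⊖ h u)      ≡⟨ cong ƛ (h-⊕ u v i v≢e) ⟨
      ƛ (h (u ⊕ v))      ∎

  -- `⊖` plants `w` at the end of the rightmost spine of `t`; after reversal `h w` stands to the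
  -- left of all that comes from `t`.
  h-⊖ : ∀ t w → h (t ⊖ w) ≡ h w ⊕ h t
  h-⊖ t w = go (view t)
    where
    go : ∀ {t} → View t → h (t ⊖ w) ≡ h w ⊕ h t
    go empty = begin
      h (e ⊖ w)  ≡⟨ cong h (⊖-e w) ⟩
      h w        ≡⟨ identityʳ (h w) ⟨
      h w ⊕ e    ≡⟨ cong (h w ⊕_) h-e ⟨
      h w ⊕ h e  ∎
    go (indec {s} p) = begin
      h (ƛ s ⊖ w)    ≡⟨ cong h (⊖-ƛ s w) ⟩
      h (ƛ (s ⊖ w))  ≡⟨ h-ƛ (s ⊖ w) ⟩
      γ (h (s ⊖ w))  ≡⟨ cong γ (go p) ⟩
      γ (h w ⊕ h s)  ≡⟨ assoc (h w) (h s) (ƛ e) ⟩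
      h w ⊕ γ (h s)  ≡⟨ cong (h w ⊕_) (h-ƛ s) ⟨
      h w ⊕ h (ƛ s)  ∎
    go (dec {u} {v} i v≢e _ q) = begin
      h ((u ⊕ v) ⊖ w)    ≡⟨ cong h (⊖-⊕ u v w (indec⇒≢e i) v≢e) ⟩
      h (u ⊕ (v ⊖ w))    ≡⟨ h-⊕ u (v ⊖ w) i (⊖-≢eˡ w v≢e) ⟩
      h (v ⊖ w) ⊖ h u    ≡⟨ cong (_⊖ h u) (go q) ⟩
      -- `h w` may be empty here, so `⊖-⊕` itself would not do; `h v` is nonempty because `v` is.
      (h w ⊕ h v) ⊖ h u  ≡⟨ ⊕-⊖-assoc (h w) (h u) (h-≢e v≢e) ⟩
      h w ⊕ (h v ⊖ h u)  ≡⟨ cong (h w ⊕_) (h-⊕ u v i v≢e) ⟨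
      h w ⊕ h (u ⊕ v)    ∎

  h-involutive : ∀ t → h (h t) ≡ t
  h-involutive t = go (view t)
    where
    go : ∀ {t} → View t → h (h t) ≡ t
    go empty = trans (cong h h-e) h-e
    go (indec {s} p) = begin
      h (h (ƛ s))  ≡⟨ cong h (h-ƛ s) ⟩
      h (γ (h s))  ≡⟨ h-γ (h s) ⟩
      ƛ (h (h s))  ≡⟨ cong ƛ (go p) ⟩
      ƛ s          ∎
    go (dec {u} {v} i v≢e p q) = begin
      h (h (u ⊕ v))      ≡⟨ cong h (h-⊕ u v i v≢e) ⟩
      -- The second reversal undoes the first, so the factors return to their original order.
      h (h v ⊖ h u)      ≡⟨ h-⊖ (h v) (h u) ⟩
      h (h u) ⊕ h (h v)  ≡⟨ cong₂ _⊕_ (go p) (go q) ⟩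
      u ⊕ v              ∎

theorem2p9 : ∀ {ℓ : Level} (S : CatalanStructure ℓ) →
    let open Catalan S in
    ∀ (t : C) → h (h t) ≡ t
theorem2p9 S = h-involutive S
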